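{- Let $m$ be a positive integer and let $\mathcal Z$ be a three-class symmetric association scheme with adjacency matrices $A_0=I,A_1,A_2,A_3$ whose character table is $$P=\begin{bmatrix}1&m(m-1)&m(m+1)&(m-1)(m+1)\\1&m&0&-m-1\\1&0&-m&m-1\\1&-m&m&-1\end{bmatrix}.$$ Then $A_1$, $A_2$ and $A_3+A_0$ are incidence matrices of symmetric partial geometric designs with parameters $(v,k;\alpha,\beta)$ respectively $$\big(3m^2,\ m(m-1);\ \tfrac13m^2(m^2-3m+2),\ \tfrac13m^2(m^2-3m+5)\big),$$ $$\big(3m^2,\ m(m+1);\ \tfrac13m^2(m^2+3m+2),\ \tfrac13m^2(m^2+3m+5)\big),$$ $$\big(3m^2,\ m^2;\ \tfrac13m^2(m^2-1),\ \tfrac13m^2(m^2+2)\big).$$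
   Context: A three-class symmetric association scheme has symmetric $0/1$ adjacency matrices $A_0=I,A_1,A_2,A_3$ summing to the all-ones matrix $J$ with $A_iA_j=\sum_hp_{ij}^hA_h$. Its character table is the matrix $P$ with $P_{ij}=p_j(i)$, where $A_j=\sum_i p_j(i)E_i$ and $E_0=\frac1{|X|}J,E_1,E_2,E_3$ are the primitive idempotents of the Bose–Mesner algebra. A symmetric partial geometric design with parameters $(v,k;\alpha,\beta)$ is a design with $v$ points and $v$ blocks, each block of size $k$, each point in $k$ blocks, whose incidence matrix $N$ satisfies $NN^TN=\beta N+\alpha(J-N)$. -}

module Defs where

open import Level using (Level; _⊔_)
open import Algebra.Bundles using (CommutativeRing; Semiring)
open import Algebra.Bundles.Raw using (RawSemiring)
open import Algebra.Apartness.Bundles using (HeytingField; HeytingCommutativeRing)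
import Algebra.Definitions.RawMonoid as RawMonoidOps
open import Data.Nat.Base as ℕ using (ℕ; suc)
open import Data.Integer.Base as ℤ using (+_)
open import Data.Rational.Base as ℚ using (ℚ; 1ℚ)
open import Data.Fin.Base using (Fin; zero; suc)
open import Data.Fin.Properties using (_≟_)
open import Data.Product.Base using (∃)
open import Data.Sum.Base using (_⊎_)
open import Data.Vec.Functional using (Vector; []; _∷_)
open import Relation.Binary.PropositionalEquality using (_≡_; _≢_)
open import Relation.Nullary.Decidable.Core using (does)
open import Relation.Nullary.Negation.Core using (¬_)
open import Data.Bool.Base using (if_then_else_)

private
  variable
    a c ℓ₁ ℓ₂ : Level

Matrix : Set a → ℕ → ℕ → Set a
Matrix X p q = Fin p → Fin q → X

transpose : {X : Set a} {p q : ℕ} → Matrix X p q → Matrix X q p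
transpose M i j = M j i

module MatrixOps {c ℓ : Level} (R : RawSemiring c ℓ) where
  open RawSemiring R
  open RawMonoidOps +-rawMonoid public using (sum) renaming (_×_ to _·ℕ_)

  infix  4 _≈ᴹ_
  infixl 6 _+ᴹ_
  infixl 7 _*ᴹ_

  _≈ᴹ_ : {p q : ℕ} → Matrix Carrier p q → Matrix Carrier p q → Set ℓ
  M ≈ᴹ N = ∀ i j → M i j ≈ N i j

  _+ᴹ_ : {p q : ℕ} → Matrix Carrier p q → Matrix Carrier p q → Matrix Carrier p q
  (M +ᴹ N) i j = M i j + N i j

  _*ᴹ_ : {p q r : ℕ} → Matrix Carrier p q → Matrix Carrier q r → Matrix Carrier p r
  (M *ᴹ N) i j = sum (λ l → M i l * N l j)

  0ᴹ : {p q : ℕ} → Matrix Carrier p q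
  0ᴹ i j = 0#

  I : {p : ℕ} → Matrix Carrier p p
  I i j = if does (i ≟ j) then 1# else 0#

  J : {p q : ℕ} → Matrix Carrier p q
  J i j = 1#

  linComb : {d p q : ℕ} → Vector Carrier d → Vector (Matrix Carrier p q) d →
            Matrix Carrier p q
  linComb λs Ms i j = sum (λ h → λs h * Ms h i j)

  fromℕ : ℕ → Carrier
  fromℕ n = n ·ℕ 1#

  embed : {p q : ℕ} → Matrix ℕ p q → Matrix Carrier p q
  embed N i j = fromℕ (N i j)

module ℕᴹ = MatrixOps ℕ.+-*-rawSemiring
module ℚᴹ = MatrixOps ℚ.+-*-rawSemiring

IsZeroOne : {p q : ℕ} → Matrix ℕ p q → Set
IsZeroOne M = ∀ i j → M i j ≡ 0 ⊎ M i j ≡ 1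

record SymmetricAssociationScheme (d n : ℕ) : Set where
  open ℕᴹ
  field
    A         : Fin (suc d) → Matrix ℕ n n
    p         : (h i j : Fin (suc d)) → ℕ
    zeroOne   : ∀ i → IsZeroOne (A i)
    symmetric : ∀ i → transpose (A i) ≈ᴹ A i
    A₀≈I      : A zero ≈ᴹ I
    sum≈J     : (λ x y → sum (λ i → A i x y)) ≈ᴹ J
    A*A       : ∀ i j → A i *ᴹ A j ≈ᴹ linComb (λ h → p h i j) A

-- Heyting fields are the constructive notion of field; ℝ and ℂ are instances,
-- with _#_ being the apartness relation (classically, ≠).
fieldSemiring : HeytingField c ℓ₁ ℓ₂ → RawSemiring c ℓ₁
fieldSemiring K = Semiring.rawSemiring (CommutativeRing.semiring
  (HeytingCommutativeRing.commutativeRing (HeytingField.heytingCommutativeRing K)))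

CharacteristicZero : HeytingField c ℓ₁ ℓ₂ → Set ℓ₂
CharacteristicZero K = ∀ n → fromℕ (suc n) # 0#
  where
  open HeytingField K using (_#_; 0#)
  open MatrixOps (fieldSemiring K) using (fromℕ)

module BoseMesner {c ℓ₁ ℓ₂ : Level} (K : HeytingField c ℓ₁ ℓ₂)
                  {d n : ℕ} (𝒵 : SymmetricAssociationScheme d n) where
  open HeytingField K using (Carrier; _≈_; _*_)
  open MatrixOps (fieldSemiring K)
  open SymmetricAssociationScheme 𝒵

  Aᴷ : Vector (Matrix Carrier n n) (suc d)
  Aᴷ i = embed (A i)

  _∈BM : Matrix Carrier n n → Set (c ⊔ ℓ₁)
  M ∈BM = ∃ λ (λs : Vector Carrier (suc d)) → M ≈ᴹ linComb λs Aᴷ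

  record IsNonzeroIdempotent (E : Matrix Carrier n n) : Set (c ⊔ ℓ₁) where
    field
      inBM       : E ∈BM
      nonzero    : ¬ (E ≈ᴹ 0ᴹ)
      idempotent : E *ᴹ E ≈ᴹ E

  -- The algebra is commutative, so F *ᴹ G ≈ᴹ 0ᴹ already makes F and G orthogonal.
  record IsPrimitiveIdempotent (E : Matrix Carrier n n) : Set (c ⊔ ℓ₁) where
    field
      isNonzeroIdempotent : IsNonzeroIdempotent E
      indecomposable      : ∀ F G → IsNonzeroIdempotent F → IsNonzeroIdempotent G →
                            F *ᴹ G ≈ᴹ 0ᴹ → ¬ (E ≈ᴹ F +ᴹ G)

  -- P i j is p_j(i): rows index the idempotents, columns the relations.
  record IsCharacterTable (P : Matrix Carrier (suc d) (suc d)) : Set (c ⊔ ℓ₁) where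
    field
      E         : Vector (Matrix Carrier n n) (suc d)
      -- E₀ = (1/|X|) J with the denominator cleared.
      E₀        : (λ x y → fromℕ n * E zero x y) ≈ᴹ J
      isPrim    : ∀ i → IsPrimitiveIdempotent (E i)
      distinct  : ∀ i j → i ≢ j → ¬ (E i ≈ᴹ E j)
      complete  : ∀ F → IsPrimitiveIdempotent F → ∃ λ i → F ≈ᴹ E i
      expansion : ∀ j → Aᴷ j ≈ᴹ linComb (λ i → P i j) E

open BoseMesner public using (IsCharacterTable)

-- N is an incidence matrix (rows are points, columns are blocks) of a symmetric
-- partial geometric design with parameters (v , k ; α , β).
record IsSymmetricPGD {points blocks : ℕ} (N : Matrix ℕ points blocks)
                      (v k : ℕ) (α β : ℚ) : Set where
  open ℚᴹ using (_≈ᴹ_; _*ᴹ_; embed)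
  Nℚ : Matrix ℚ points blocks
  Nℚ = embed N
  field
    points≡v    : points ≡ v
    blocks≡v    : blocks ≡ v
    zeroOne     : IsZeroOne N
    blockSize   : ∀ B → ℕᴹ.sum (λ x → N x B) ≡ k
    replication : ∀ x → ℕᴹ.sum (λ B → N x B) ≡ k
    NNᵀN        : Nℚ *ᴹ transpose Nℚ *ᴹ Nℚ ≈ᴹ
                  (λ x B → β ℚ.* Nℚ x B ℚ.+ α ℚ.* (1ℚ ℚ.- Nℚ x B))

table : (K : HeytingField c ℓ₁ ℓ₂) → ℕ → Matrix (HeytingField.Carrier K) 4 4
table K m =
    (1# ∷ m̂ * (m̂ - 1#) ∷ m̂ * (m̂ + 1#) ∷ (m̂ - 1#) * (m̂ + 1#) ∷ [])
  ∷ (1# ∷ m̂            ∷ 0#           ∷ - m̂ - 1#              ∷ [])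
  ∷ (1# ∷ 0#           ∷ - m̂          ∷ m̂ - 1#                ∷ [])
  ∷ (1# ∷ - m̂          ∷ m̂            ∷ - 1#                  ∷ [])
  ∷ []
  where
  open HeytingField K using (Carrier; _+_; _*_; _-_; -_; 0#; 1#)
  m̂ : Carrier
  m̂ = MatrixOps.fromℕ (fieldSemiring K) m

{-# OPTIONS --safe #-}
-- The primitive idempotents are pairwise orthogonal, so polynomials in a matrix
-- N = Σ θᵢ Eᵢ of the Bose–Mesner algebra are evaluated eigenvalue by eigenvalue.
-- For each of the three designs θ₀ = k, while θ₁, θ₂, θ₃ are m, 0 and -m in some order,
-- hence roots of x³ = m²x.  Therefore N³ - m²N = (k³ - m²k) E₀ with E₀ = J/n, and
-- n = 3m² is the sum of the three values of k, because N₁ + N₂ + N₃ = J.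
module Submission where

open import Defs
open import Algebra.Apartness.Bundles using (HeytingCommutativeRing; HeytingField)
open import Data.Nat.Base using (ℕ; NonZero; _∸_) renaming (_+_ to _+ℕ_; _*_ to _*ℕ_; _^_ to _^ℕ_)
open import Data.Fin.Patterns using (0F; 1F; 2F; 3F)
open import Data.Product.Base using (_×_)

open import Algebra.Bundles using (CommutativeRing; CommutativeSemiring; RingWithoutOne)
import Algebra.Apartness.Properties.HeytingCommutativeRing as HeytingCommutativeRingProperties
import Algebra.Properties.CommutativeSemigroup as CommutativeSemigroupProperties
import Algebra.Properties.Ring as RingProperties
import Algebra.Properties.RingWithoutOne as RingWithoutOneProperties
import Algebra.Properties.Semiring.Mult as SemiringMult
import Algebra.Properties.Semiring.Sum as SemiringSum
open import Data.Empty using (⊥-elim)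
open import Data.Fin.Base using (Fin; zero; suc; punchIn)
open import Data.Fin.Properties using (punchInᵢ≢i)
import Data.Integer.Base as ℤ
import Data.Integer.Properties as ℤ
import Data.Integer.Tactic.RingSolver as ℤSolver
open import Data.Nat.Base using (zero; suc)
import Data.Nat.Properties as ℕ
import Data.Nat.Tactic.RingSolver as ℕSolver
open import Data.Product.Base using (_,_; proj₁; proj₂)
import Data.Rational.Base as ℚ
import Data.Rational.Properties as ℚ
import Data.Rational.Unnormalised.Base as ℚᵘ
import Data.Rational.Unnormalised.Properties as ℚᵘ
open import Data.Sum.Base using (inj₁; inj₂)
open import Data.Vec.Functional using (Vector; removeAt)
import Relation.Binary.Reasoning.Setoid as SetoidReasoning
open import Relation.Binary.PropositionalEquality
  using (_≡_; _≢_; refl; sym; trans; cong; cong₂; subst; module ≡-Reasoning)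
open import Relation.Nullary.Negation using (¬_)

-- Orthogonality is not part of the definition of a character table; it has to be drawn from
-- indecomposability. For primitive idempotents E and F with EF nonzero, the splitting E = EF + (E -
-- EF) forces E = EF, and by symmetry F = FE, so E = F by commutativity. The argument is by
-- contradiction, which is sound over a Heyting field because tightness makes equality stable under
-- double negation. The spectral identity lives in `K`, the design equation in ℚ. They meet in ℕ:
-- characteristic zero makes ℕ → `K` injective, so an identity between counts descends to ℕ and then
-- maps to ℚ. Hence the form n N³ + m²k J = n m² N + k³ J, free of subtraction and division. With n
-- = 3m² this says N³ = m² N + α J for α = (k³ - m²k) / 3m². As N is symmetric, it is the design
-- equation with β = α + m²; this is the origin of the stated parameters.

-- Splitting an idempotent by another one that commutes with it.

module CommutingIdempotents {c ℓ} (R : RingWithoutOne c ℓ) where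
  open RingWithoutOne R hiding (refl; sym; trans)
  open RingWithoutOneProperties R
  open SetoidReasoning setoid
  private module R = RingWithoutOne R

  module _ {e f} (e² : e * e ≈ e) (f² : f * f ≈ f) (ef≈fe : e * f ≈ f * e) where

    e[ef]≈ef : e * (e * f) ≈ e * f
    e[ef]≈ef = R.trans (R.sym (*-assoc e e f)) (*-congʳ e²)

    f[ef]≈ef : f * (e * f) ≈ e * f
    f[ef]≈ef = begin
      f * (e * f)  ≈⟨ *-congˡ ef≈fe ⟩
      f * (f * e)  ≈⟨ *-assoc f f e ⟨
      f * f * e    ≈⟨ *-congʳ f² ⟩
      f * e        ≈⟨ ef≈fe ⟨
      e * f        ∎

    [ef]e≈ef : e * f * e ≈ e * f
    [ef]e≈ef = begin
      e * f * e    ≈⟨ *-assoc e f e ⟩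
      e * (f * e)  ≈⟨ *-congˡ ef≈fe ⟨
      e * (e * f)  ≈⟨ e[ef]≈ef ⟩
      e * f        ∎

    ef-idempotent : e * f * (e * f) ≈ e * f
    ef-idempotent = begin
      e * f * (e * f)    ≈⟨ *-assoc e f (e * f) ⟩
      e * (f * (e * f))  ≈⟨ *-congˡ f[ef]≈ef ⟩
      e * (e * f)        ≈⟨ e[ef]≈ef ⟩
      e * f              ∎

    -- With `ef-idempotent`, `e-ef-idempotent` and `x≈y+[x-y]` this exhibits `e` as a sum of two
    -- orthogonal idempotents, the shape that indecomposability excludes when both are nonzero.
    ef[e-ef]≈0 : e * f * (e - e * f) ≈ 0#
    ef[e-ef]≈0 = begin
      e * f * (e - e * f)            ≈⟨ x[y-z]≈xy-xz (e * f) e (e * f) ⟩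
      e * f * e - e * f * (e * f)    ≈⟨ +-cong [ef]e≈ef (-‿cong ef-idempotent) ⟩
      e * f - e * f                  ≈⟨ -‿inverseʳ (e * f) ⟩
      0#                             ∎

    e-ef-idempotent : (e - e * f) * (e - e * f) ≈ e - e * f
    e-ef-idempotent = begin
      (e - e * f) * (e - e * f)              ≈⟨ [y-z]x≈yx-zx (e - e * f) e (e * f) ⟩
      e * (e - e * f) - e * f * (e - e * f)  ≈⟨ +-cong (x[y-z]≈xy-xz e e (e * f)) (-‿cong ef[e-ef]≈0) ⟩
      e * e - e * (e * f) - 0#               ≈⟨ +-cong (+-cong e² (-‿cong e[ef]≈ef)) -0#≈0# ⟩
      e - e * f + 0#                         ≈⟨ +-identityʳ (e - e * f) ⟩
      e - e * f                              ∎

  x≈y+[x-y] : ∀ x y → x ≈ y + (x - y)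
  x≈y+[x-y] x y = begin
    x              ≈⟨ +-identityˡ x ⟨
    0# + x         ≈⟨ +-congʳ (-‿inverseʳ y) ⟨
    y - y + x      ≈⟨ +-assoc y (- y) x ⟩
    y + (- y + x)  ≈⟨ +-congˡ (+-comm (- y) x) ⟩
    y + (x - y)    ∎

  x-y≈0⇒x≈y : ∀ x y → x - y ≈ 0# → x ≈ y
  x-y≈0⇒x≈y x y x-y≈0 = begin
    x            ≈⟨ x≈y+[x-y] x y ⟩
    y + (x - y)  ≈⟨ +-congˡ x-y≈0 ⟩
    y + 0#       ≈⟨ +-identityʳ y ⟩
    y            ∎

-- Matrix algebra over a commutative semiring, and the passage from ℕ-matrices.

module MatrixProperties {c ℓ} (S : CommutativeSemiring c ℓ) where
  open CommutativeSemiring S hiding (zero; refl; sym; trans)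
  open MatrixOps rawSemiring
  open SemiringSum semiring using (sum-cong-≋; sum-remove; sum-replicate-zero;
    ∑-comm; ∑-distrib-+; *-distribˡ-sum; *-distribʳ-sum)
  open SemiringMult semiring using (×-homo-+; ×-congˡ; ×1-homo-*)
  open CommutativeSemigroupProperties *-commutativeSemigroup using (x∙yz≈y∙xz)
  open SetoidReasoning setoid
  private module S = CommutativeSemiring S

  *ᴹ-cong : ∀ {p q r} {M M′ : Matrix Carrier p q} {N N′ : Matrix Carrier q r} →
            M ≈ᴹ M′ → N ≈ᴹ N′ → M *ᴹ N ≈ᴹ M′ *ᴹ N′
  *ᴹ-cong M≈M′ N≈N′ i j = sum-cong-≋ λ l → *-cong (M≈M′ i l) (N≈N′ l j)

  *ᴹ-assoc : ∀ {p q r s} (L : Matrix Carrier p q) (M : Matrix Carrier q r) (N : Matrix Carrier r s) →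
             L *ᴹ M *ᴹ N ≈ᴹ L *ᴹ (M *ᴹ N)
  *ᴹ-assoc L M N i j = begin
    sum (λ l → sum (λ h → L i h * M h l) * N l j)    ≈⟨ sum-cong-≋ (λ l → *-distribʳ-sum (N l j) (λ h → L i h * M h l)) ⟩
    sum (λ l → sum (λ h → L i h * M h l * N l j))    ≈⟨ ∑-comm (λ l h → L i h * M h l * N l j) ⟩
    sum (λ h → sum (λ l → L i h * M h l * N l j))    ≈⟨ sum-cong-≋ (λ h → sum-cong-≋ λ l → *-assoc (L i h) (M h l) (N l j)) ⟩
    sum (λ h → sum (λ l → L i h * (M h l * N l j)))  ≈⟨ sum-cong-≋ (λ h → *-distribˡ-sum (L i h) (λ l → M h l * N l j)) ⟨
    sum (λ h → L i h * sum (λ l → M h l * N l j))    ∎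

  *ᴹ-distribˡ-+ᴹ : ∀ {p q r} (L : Matrix Carrier p q) (M N : Matrix Carrier q r) →
                   L *ᴹ (M +ᴹ N) ≈ᴹ L *ᴹ M +ᴹ L *ᴹ N
  *ᴹ-distribˡ-+ᴹ L M N i j =
    S.trans (sum-cong-≋ λ l → distribˡ (L i l) (M l j) (N l j))
      (∑-distrib-+ (λ l → L i l * M l j) (λ l → L i l * N l j))

  *ᴹ-distribʳ-+ᴹ : ∀ {p q r} (L : Matrix Carrier q r) (M N : Matrix Carrier p q) →
                   (M +ᴹ N) *ᴹ L ≈ᴹ M *ᴹ L +ᴹ N *ᴹ L
  *ᴹ-distribʳ-+ᴹ L M N i j =
    S.trans (sum-cong-≋ λ l → distribʳ (L l j) (M i l) (N i l))
      (∑-distrib-+ (λ l → M i l * L l j) (λ l → N i l * L l j))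

  transpose-*ᴹ : ∀ {p q r} (M : Matrix Carrier p q) (N : Matrix Carrier q r) →
                 transpose (M *ᴹ N) ≈ᴹ transpose N *ᴹ transpose M
  transpose-*ᴹ M N i j = sum-cong-≋ λ l → *-comm (M j l) (N l i)

  sum-single : ∀ {d} (t : Vector Carrier d) j → (∀ i → i ≢ j → t i ≈ 0#) → sum t ≈ t j
  sum-single {suc d} t j vanishes = begin
    sum t                     ≈⟨ sum-remove {i = j} t ⟩
    t j + sum (removeAt t j)  ≈⟨ +-congˡ (sum-cong-≋ λ i → vanishes (punchIn j i) (punchInᵢ≢i j i)) ⟩
    t j + sum {d} (λ _ → 0#)  ≈⟨ +-congˡ (sum-replicate-zero d) ⟩
    t j + 0#                  ≈⟨ +-identityʳ (t j) ⟩
    t j                       ∎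

  linComb-cong : ∀ {d p q} {λs μs : Vector Carrier d} {Ms Ns : Vector (Matrix Carrier p q) d} →
                 (∀ h → λs h ≈ μs h) → (∀ h → Ms h ≈ᴹ Ns h) → linComb λs Ms ≈ᴹ linComb μs Ns
  linComb-cong λ≈μ M≈N i j = sum-cong-≋ λ h → *-cong (λ≈μ h) (M≈N h i j)

  linComb-+ : ∀ {d p q} (λs μs : Vector Carrier d) (Ms : Vector (Matrix Carrier p q) d) →
              linComb λs Ms +ᴹ linComb μs Ms ≈ᴹ linComb (λ h → λs h + μs h) Ms
  linComb-+ λs μs Ms i j = S.sym
    (S.trans (sum-cong-≋ λ h → distribʳ (Ms h i j) (λs h) (μs h))
      (∑-distrib-+ (λ h → λs h * Ms h i j) (λ h → μs h * Ms h i j)))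

  linComb-*ᴹ : ∀ {d p q r} (λs : Vector Carrier d) (Ms : Vector (Matrix Carrier p q) d)
               (N : Matrix Carrier q r) → linComb λs Ms *ᴹ N ≈ᴹ linComb λs (λ h → Ms h *ᴹ N)
  linComb-*ᴹ λs Ms N i j = begin
    sum (λ l → sum (λ h → λs h * Ms h i l) * N l j)    ≈⟨ sum-cong-≋ (λ l → *-distribʳ-sum (N l j) (λ h → λs h * Ms h i l)) ⟩
    sum (λ l → sum (λ h → λs h * Ms h i l * N l j))    ≈⟨ ∑-comm (λ l h → λs h * Ms h i l * N l j) ⟩
    sum (λ h → sum (λ l → λs h * Ms h i l * N l j))    ≈⟨ sum-cong-≋ (λ h → sum-cong-≋ λ l → *-assoc (λs h) (Ms h i l) (N l j)) ⟩
    sum (λ h → sum (λ l → λs h * (Ms h i l * N l j)))  ≈⟨ sum-cong-≋ (λ h → *-distribˡ-sum (λs h) (λ l → Ms h i l * N l j)) ⟨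
    sum (λ h → λs h * sum (λ l → Ms h i l * N l j))    ∎

  *ᴹ-linComb : ∀ {d p q r} (M : Matrix Carrier p q) (μs : Vector Carrier d)
               (Ns : Vector (Matrix Carrier q r) d) →
               M *ᴹ linComb μs Ns ≈ᴹ linComb μs (λ h → M *ᴹ Ns h)
  *ᴹ-linComb M μs Ns i j = begin
    sum (λ l → M i l * sum (λ h → μs h * Ns h l j))    ≈⟨ sum-cong-≋ (λ l → *-distribˡ-sum (M i l) (λ h → μs h * Ns h l j)) ⟩
    sum (λ l → sum (λ h → M i l * (μs h * Ns h l j)))  ≈⟨ ∑-comm (λ l h → M i l * (μs h * Ns h l j)) ⟩
    sum (λ h → sum (λ l → M i l * (μs h * Ns h l j)))  ≈⟨ sum-cong-≋ (λ h → sum-cong-≋ λ l → x∙yz≈y∙xz (M i l) (μs h) (Ns h l j)) ⟩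
    sum (λ h → sum (λ l → μs h * (M i l * Ns h l j)))  ≈⟨ sum-cong-≋ (λ h → *-distribˡ-sum (μs h) (λ l → M i l * Ns h l j)) ⟨
    sum (λ h → μs h * sum (λ l → M i l * Ns h l j))    ∎

  linComb-linComb : ∀ {d e p q} (λs : Vector Carrier d) (Λ : Fin d → Vector Carrier e)
                    (Ms : Vector (Matrix Carrier p q) e) →
                    linComb λs (λ h → linComb (Λ h) Ms) ≈ᴹ linComb (λ g → sum (λ h → λs h * Λ h g)) Ms
  linComb-linComb λs Λ Ms i j = begin
    sum (λ h → λs h * sum (λ g → Λ h g * Ms g i j))    ≈⟨ sum-cong-≋ (λ h → *-distribˡ-sum (λs h) (λ g → Λ h g * Ms g i j)) ⟩
    sum (λ h → sum (λ g → λs h * (Λ h g * Ms g i j)))  ≈⟨ ∑-comm (λ h g → λs h * (Λ h g * Ms g i j)) ⟩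
    sum (λ g → sum (λ h → λs h * (Λ h g * Ms g i j)))  ≈⟨ sum-cong-≋ (λ g → sum-cong-≋ λ h → *-assoc (λs h) (Λ h g) (Ms g i j)) ⟨
    sum (λ g → sum (λ h → λs h * Λ h g * Ms g i j))    ≈⟨ sum-cong-≋ (λ g → *-distribʳ-sum (Ms g i j) (λ h → λs h * Λ h g)) ⟨
    sum (λ g → sum (λ h → λs h * Λ h g) * Ms g i j)    ∎

  fromℕ-sum : ∀ {d} (t : Vector ℕ d) → fromℕ (ℕᴹ.sum t) ≈ sum (λ i → fromℕ (t i))
  fromℕ-sum {zero}  t = S.refl
  fromℕ-sum {suc d} t = S.trans (×-homo-+ 1# (t zero) _) (+-congˡ (fromℕ-sum (λ i → t (suc i))))

  embed-*ᴹ : ∀ {p q r} (M : Matrix ℕ p q) (N : Matrix ℕ q r) →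
             embed (M ℕᴹ.*ᴹ N) ≈ᴹ embed M *ᴹ embed N
  embed-*ᴹ M N i j = S.trans (fromℕ-sum (λ l → M i l *ℕ N l j)) (sum-cong-≋ λ l → ×1-homo-* (M i l) (N l j))

  embed-linComb : ∀ {d p q} (λs : Vector ℕ d) (Ms : Vector (Matrix ℕ p q) d) →
                  embed (ℕᴹ.linComb λs Ms) ≈ᴹ linComb (λ h → fromℕ (λs h)) (λ h → embed (Ms h))
  embed-linComb λs Ms i j = S.trans (fromℕ-sum (λ h → λs h *ℕ Ms h i j)) (sum-cong-≋ λ h → ×1-homo-* (λs h) (Ms h i j))

  embed-cong : ∀ {p q} {M N : Matrix ℕ p q} → M ℕᴹ.≈ᴹ N → embed M ≈ᴹ embed N
  embed-cong M≈N i j = ×-congˡ (M≈N i j)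

-- The complement of `e * f` inside `e` is written `e - e * f` rather than `e * (1 - f)`, so a ring
-- without identity is the structure in which the splitting is computed.
matrixRing : ∀ {c ℓ} (R : CommutativeRing c ℓ) → ℕ → RingWithoutOne c ℓ
matrixRing R n = record
  { Carrier = Matrix R.Carrier n n
  ; _≈_ = _≈ᴹ_
  ; _+_ = MatrixOps._+ᴹ_ rawSemiring
  ; _*_ = _*ᴹ_
  ; -_ = λ M i j → R.- M i j
  ; 0# = 0ᴹ
  ; isRingWithoutOne = record
    { +-isAbelianGroup = record
      { isGroup = record
        { isMonoid = record
          { isSemigroup = record
            { isMagma = record
              { isEquivalence = record
                { refl  = λ i j → R.refl
                ; sym   = λ M≈N i j → R.sym (M≈N i j)
                ; trans = λ L≈M M≈N i j → R.trans (L≈M i j) (M≈N i j)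
                }
              ; ∙-cong = λ L≈M N≈O i j → R.+-cong (L≈M i j) (N≈O i j)
              }
            ; assoc = λ L M N i j → R.+-assoc (L i j) (M i j) (N i j)
            }
          ; identity = (λ M i j → R.+-identityˡ (M i j)) , (λ M i j → R.+-identityʳ (M i j))
          }
        ; inverse = (λ M i j → R.-‿inverseˡ (M i j)) , (λ M i j → R.-‿inverseʳ (M i j))
        ; ⁻¹-cong = λ M≈N i j → R.-‿cong (M≈N i j)
        }
      ; comm = λ M N i j → R.+-comm (M i j) (N i j)
      }
    ; *-cong  = *ᴹ-cong
    ; *-assoc = *ᴹ-assoc
    ; distrib = *ᴹ-distribˡ-+ᴹ , *ᴹ-distribʳ-+ᴹ
    }
  }
  where
  module R = CommutativeRing R
  open CommutativeSemiring R.commutativeSemiring using (rawSemiring)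
  open MatrixOps rawSemiring using (_≈ᴹ_; _*ᴹ_; 0ᴹ)
  open MatrixProperties R.commutativeSemiring

-- Stability of equality, and descent from the field to ℕ.

fieldRing : ∀ {c ℓ₁ ℓ₂} → HeytingField c ℓ₁ ℓ₂ → CommutativeRing c ℓ₁
fieldRing K = HeytingCommutativeRing.commutativeRing (HeytingField.heytingCommutativeRing K)

module FieldProperties {c ℓ₁ ℓ₂} (K : HeytingField c ℓ₁ ℓ₂) where
  open HeytingField K hiding (zero; refl; sym; trans)
  open HeytingCommutativeRingProperties heytingCommutativeRing using (#-congʳ)
  open CommutativeRing (fieldRing K) using (ring)
  open RingProperties ring using (+-cancelˡ)
  open MatrixOps (fieldSemiring K) using (fromℕ)
  private module K = HeytingField K

  -- Tightness identifies `x ≈ y` with the negation of `x # y`, and negations are stable. Entrywise,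
  -- this licenses proofs of matrix equations by contradiction.
  ≈-stable : ∀ {x y} → ¬ ¬ x ≈ y → x ≈ y
  ≈-stable {x} {y} ¬¬x≈y =
    proj₁ (tight x y) λ x#y → ¬¬x≈y λ x≈y → proj₂ (tight x y) x≈y x#y

  -- The way back from `K`: row sums and entries of powers of an ℕ-matrix are computed spectrally in
  -- `K`, then compared in ℕ.
  fromℕ-injective : CharacteristicZero K → ∀ i j → fromℕ i ≈ fromℕ j → i ≡ j
  fromℕ-injective char0 zero zero _ = refl
  fromℕ-injective char0 zero (suc j) eq =
    ⊥-elim (proj₂ (tight 0# 0#) K.refl (#-congʳ (K.sym eq) (char0 j)))
  fromℕ-injective char0 (suc i) zero eq =
    ⊥-elim (proj₂ (tight 0# 0#) K.refl (#-congʳ eq (char0 i)))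
  fromℕ-injective char0 (suc i) (suc j) eq =
    cong suc (fromℕ-injective char0 i j (+-cancelˡ 1# (fromℕ i) (fromℕ j) eq))

-- Orthogonality of the primitive idempotents and the spectral calculus.

module SpectralDecomposition {c ℓ₁ ℓ₂} (K : HeytingField c ℓ₁ ℓ₂)
  {d n} (𝒵 : SymmetricAssociationScheme d n) {P} (ct : IsCharacterTable K 𝒵 P) where

  open CommutativeRing (fieldRing K) hiding (zero; refl; sym; trans)
  open MatrixOps (fieldSemiring K)
  open MatrixProperties commutativeSemiring
  open SemiringSum semiring using (sum-cong-≋; *-distribˡ-sum)
  open SemiringMult semiring using (×-homo-+; ×1-homo-*)
  open CommutativeSemigroupProperties *-commutativeSemigroup using (x∙yz≈y∙xz)
  open RingProperties ring using (-‿distribˡ-*; -1*x≈-x)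
  open FieldProperties K
  open SymmetricAssociationScheme 𝒵
  open BoseMesner K 𝒵 hiding (IsCharacterTable)
  open IsNonzeroIdempotent
  open IsPrimitiveIdempotent
  open BoseMesner.IsCharacterTable ct public
  private
    module K = CommutativeRing (fieldRing K)
    module 𝕄 = RingWithoutOne (matrixRing (fieldRing K) n)
  open CommutingIdempotents (matrixRing (fieldRing K) n)

  ∈BM-symmetric : ∀ {M} → M ∈BM → transpose M ≈ᴹ M
  ∈BM-symmetric {M} (λs , M≈) x y = begin
    M y x                ≈⟨ M≈ y x ⟩
    linComb λs Aᴷ y x    ≈⟨ linComb-cong {λs = λs} (λ _ → K.refl) (λ h → embed-cong (symmetric h)) x y ⟩
    linComb λs Aᴷ x y    ≈⟨ M≈ x y ⟨
    M x y                ∎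
    where open SetoidReasoning setoid

  ∈BM-*ᴹ : ∀ {M N} → M ∈BM → N ∈BM → (M *ᴹ N) ∈BM
  ∈BM-*ᴹ {M} {N} (λs , M≈) (μs , N≈) =
    (λ h → sum (λ i → λs i * sum (λ j → μs j * fromℕ (p h i j)))) , (begin
    M *ᴹ N                                                       ≈⟨ *ᴹ-cong M≈ N≈ ⟩
    linComb λs Aᴷ *ᴹ linComb μs Aᴷ                               ≈⟨ linComb-*ᴹ λs Aᴷ (linComb μs Aᴷ) ⟩
    linComb λs (λ i → Aᴷ i *ᴹ linComb μs Aᴷ)                     ≈⟨ linComb-cong {λs = λs} (λ _ → K.refl) AᵢN ⟩
    linComb λs (λ i → linComb (λ h → sum (λ j → μs j * fromℕ (p h i j))) Aᴷ)
      ≈⟨ linComb-linComb λs (λ i h → sum (λ j → μs j * fromℕ (p h i j))) Aᴷ ⟩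
    linComb (λ h → sum (λ i → λs i * sum (λ j → μs j * fromℕ (p h i j)))) Aᴷ  ∎)
    where
    open SetoidReasoning 𝕄.setoid

    AᵢAⱼ : ∀ i j → Aᴷ i *ᴹ Aᴷ j ≈ᴹ linComb (λ h → fromℕ (p h i j)) Aᴷ
    AᵢAⱼ i j = begin
      Aᴷ i *ᴹ Aᴷ j                            ≈⟨ embed-*ᴹ (A i) (A j) ⟨
      embed (A i ℕᴹ.*ᴹ A j)                   ≈⟨ embed-cong (A*A i j) ⟩
      embed (ℕᴹ.linComb (λ h → p h i j) A)    ≈⟨ embed-linComb (λ h → p h i j) A ⟩
      linComb (λ h → fromℕ (p h i j)) Aᴷ      ∎

    AᵢN : ∀ i → Aᴷ i *ᴹ linComb μs Aᴷ ≈ᴹ linComb (λ h → sum (λ j → μs j * fromℕ (p h i j))) Aᴷ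
    AᵢN i = begin
      Aᴷ i *ᴹ linComb μs Aᴷ                                 ≈⟨ *ᴹ-linComb (Aᴷ i) μs Aᴷ ⟩
      linComb μs (λ j → Aᴷ i *ᴹ Aᴷ j)                       ≈⟨ linComb-cong {λs = μs} (λ _ → K.refl) (AᵢAⱼ i) ⟩
      linComb μs (λ j → linComb (λ h → fromℕ (p h i j)) Aᴷ)
        ≈⟨ linComb-linComb μs (λ j h → fromℕ (p h i j)) Aᴷ ⟩
      linComb (λ h → sum (λ j → μs j * fromℕ (p h i j))) Aᴷ  ∎

  ∈BM-- : ∀ {M N} → M ∈BM → N ∈BM → (M 𝕄.- N) ∈BM
  ∈BM-- {M} {N} (λs , M≈) (μs , N≈) = (λ h → λs h - μs h) , λ x y → begin
    M x y - N x y                        ≈⟨ +-cong (M≈ x y) (-‿cong (N≈ x y)) ⟩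
    linComb λs Aᴷ x y - linComb μs Aᴷ x y
      -- Membership asks for a single linear combination, so the minus sign is carried into the
      -- coefficients as the scalar `- 1#`, which distributes over the sum.
      ≈⟨ +-congˡ (-1*x≈-x (linComb μs Aᴷ x y)) ⟨
    linComb λs Aᴷ x y + - 1# * linComb μs Aᴷ x y
      ≈⟨ +-congˡ (*-distribˡ-sum (- 1#) (λ h → μs h * Aᴷ h x y)) ⟩
    linComb λs Aᴷ x y + sum (λ h → - 1# * (μs h * Aᴷ h x y))
      ≈⟨ +-congˡ (sum-cong-≋ λ h → K.trans (-1*x≈-x (μs h * Aᴷ h x y)) (-‿distribˡ-* (μs h) (Aᴷ h x y))) ⟩
    linComb λs Aᴷ x y + linComb (λ h → - μs h) Aᴷ x y
      ≈⟨ linComb-+ λs (λ h → - μs h) Aᴷ x y ⟩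
    linComb (λ h → λs h - μs h) Aᴷ x y   ∎
    where
    open SetoidReasoning setoid

  -- Commutativity comes from symmetry: the product lies in the algebra again, hence equals its own
  -- transpose, and transposing reverses the factors.
  ∈BM-comm : ∀ {M N} → M ∈BM → N ∈BM → M *ᴹ N ≈ᴹ N *ᴹ M
  ∈BM-comm {M} {N} M∈ N∈ = begin
    M *ᴹ N                      ≈⟨ ∈BM-symmetric (∈BM-*ᴹ M∈ N∈) ⟨
    transpose (M *ᴹ N)          ≈⟨ transpose-*ᴹ M N ⟩
    transpose N *ᴹ transpose M  ≈⟨ *ᴹ-cong (∈BM-symmetric N∈) (∈BM-symmetric M∈) ⟩
    N *ᴹ M                      ∎
    where open SetoidReasoning 𝕄.setoid

  -- The decomposition E = EF + (E - EF) cannot be into nonzero idempotents.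
  primitive-absorbs : ∀ {E F} → IsPrimitiveIdempotent E → IsNonzeroIdempotent F →
                      ¬ (E *ᴹ F ≈ᴹ 0ᴹ) → E ≈ᴹ E *ᴹ F
  primitive-absorbs {E} {F} primE idemF EF≉0 x y = ≈-stable λ Exy≉ →
    indecomposable primE (E *ᴹ F) (E 𝕄.- E *ᴹ F)
      record { inBM = EF∈ ; nonzero = EF≉0 ; idempotent = ef-idempotent E² F² EF≈FE }
      record { inBM = ∈BM-- E∈ EF∈
             ; nonzero = λ E-EF≈0 → Exy≉ (x-y≈0⇒x≈y E (E *ᴹ F) E-EF≈0 x y)
             ; idempotent = e-ef-idempotent E² F² EF≈FE }
      (ef[e-ef]≈0 E² F² EF≈FE)
      (x≈y+[x-y] E (E *ᴹ F))
    where
    E∈ = inBM (isNonzeroIdempotent primE)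
    F∈ = inBM idemF
    EF∈ = ∈BM-*ᴹ E∈ F∈
    E² = idempotent (isNonzeroIdempotent primE)
    F² = idempotent idemF
    EF≈FE = ∈BM-comm E∈ F∈

  idem : ∀ i → IsNonzeroIdempotent (E i)
  idem i = isNonzeroIdempotent (isPrim i)

  -- If the product were nonzero, each factor would absorb the other, and `E i` ≈ `E i *ᴹ E j` ≈
  -- `E j *ᴹ E i` ≈ `E j` would contradict distinctness. Stability is used at one entry, where a
  -- nonzero entry already makes the whole product nonzero.
  E-orthogonal : ∀ {i j} → i ≢ j → E i *ᴹ E j ≈ᴹ 0ᴹ
  E-orthogonal {i} {j} i≢j x y = ≈-stable λ EᵢEⱼxy≉0 →
    let
      EᵢEⱼ≉0 = λ EᵢEⱼ≈0 → EᵢEⱼxy≉0 (EᵢEⱼ≈0 x y)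
      EᵢEⱼ≈EⱼEᵢ = ∈BM-comm (inBM (idem i)) (inBM (idem j))
      EⱼEᵢ≉0 = λ EⱼEᵢ≈0 → EᵢEⱼ≉0 (𝕄.trans EᵢEⱼ≈EⱼEᵢ EⱼEᵢ≈0)
    in distinct i j i≢j (begin
      E i         ≈⟨ primitive-absorbs (isPrim i) (idem j) EᵢEⱼ≉0 ⟩
      E i *ᴹ E j  ≈⟨ EᵢEⱼ≈EⱼEᵢ ⟩
      E j *ᴹ E i  ≈⟨ primitive-absorbs (isPrim j) (idem i) EⱼEᵢ≉0 ⟨
      E j         ∎)
    where open SetoidReasoning 𝕄.setoid

  -- Orthogonality leaves only the `j`-th term, so `E j` consists of eigenvectors with eigenvalue
  -- `θ j`.
  linCombE*E : ∀ θ j x y → (linComb θ E *ᴹ E j) x y ≈ θ j * E j x y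
  linCombE*E θ j x y = begin
    (linComb θ E *ᴹ E j) x y          ≈⟨ linComb-*ᴹ θ E (E j) x y ⟩
    linComb θ (λ i → E i *ᴹ E j) x y
      ≈⟨ sum-single (λ i → θ i * (E i *ᴹ E j) x y) j
           (λ i i≢j → K.trans (*-congˡ (E-orthogonal i≢j x y)) (zeroʳ (θ i))) ⟩
    θ j * (E j *ᴹ E j) x y            ≈⟨ *-congˡ (idempotent (idem j) x y) ⟩
    θ j * E j x y                     ∎
    where open SetoidReasoning setoid

  linCombE*linCombE : ∀ θ η → linComb θ E *ᴹ linComb η E ≈ᴹ linComb (λ i → θ i * η i) E
  linCombE*linCombE θ η x y = begin
    (linComb θ E *ᴹ linComb η E) x y              ≈⟨ *ᴹ-linComb (linComb θ E) η E x y ⟩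
    linComb η (λ j → linComb θ E *ᴹ E j) x y      ≈⟨ sum-cong-≋ (λ j → *-congˡ {η j} (linCombE*E θ j x y)) ⟩
    sum (λ j → η j * (θ j * E j x y))             ≈⟨ sum-cong-≋ (λ j → K.trans (x∙yz≈y∙xz (η j) (θ j) (E j x y)) (K.sym (*-assoc (θ j) (η j) (E j x y)))) ⟩
    linComb (λ i → θ i * η i) E x y               ∎
    where open SetoidReasoning setoid

  -- Supplies the row along which the valencies are added up to find `n`. An empty scheme is
  -- impossible because `E zero` is nonzero.
  inhabited : Fin n
  inhabited = point E (nonzero (idem zero))
    where
    -- The size occurs in the types of the scheme and of its table, so the case split is made for an
    -- arbitrary family of matrices. In size zero every matrix vanishes vacuously.
    point : ∀ {n} (M : Vector (Matrix Carrier n n) (suc d)) → ¬ (M zero ≈ᴹ 0ᴹ) → Fin n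
    point {zero}  M M≉0 = ⊥-elim (M≉0 λ ())
    point {suc n} M M≉0 = zero

  module Spectrum (char0 : CharacteristicZero K) (N : Matrix ℕ n n)
    (θ : Vector Carrier (suc d)) (N≈θE : embed N ≈ᴹ linComb θ E)
    (k : ℕ) (θ₀≈k : θ zero ≈ fromℕ k) where

    open SetoidReasoning setoid

    -- `N E₀ = θ₀ E₀`, multiplied by `n` to turn `E₀` into `J` without a division, is read at the
    -- diagonal entry of row `x`.
    rowSum : ∀ x → ℕᴹ.sum (N x) ≡ k
    rowSum x = fromℕ-injective char0 (ℕᴹ.sum (N x)) k (begin
      fromℕ (ℕᴹ.sum (N x))                        ≈⟨ fromℕ-sum (N x) ⟩
      sum (λ y → fromℕ (N x y))                   ≈⟨ sum-cong-≋ (λ y → K.trans (K.sym (*-identityʳ (fromℕ (N x y)))) (*-congˡ (K.sym (E₀ y x)))) ⟩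
      sum (λ y → fromℕ (N x y) * (fromℕ n * E zero y x))
        ≈⟨ sum-cong-≋ (λ y → x∙yz≈y∙xz (fromℕ (N x y)) (fromℕ n) (E zero y x)) ⟩
      sum (λ y → fromℕ n * (fromℕ (N x y) * E zero y x))
        ≈⟨ *-distribˡ-sum (fromℕ n) (λ y → fromℕ (N x y) * E zero y x) ⟨
      fromℕ n * (embed N *ᴹ E zero) x x           ≈⟨ *-congˡ (*ᴹ-cong N≈θE (𝕄.refl {E zero}) x x) ⟩
      fromℕ n * (linComb θ E *ᴹ E zero) x x       ≈⟨ *-congˡ (linCombE*E θ zero x x) ⟩
      fromℕ n * (θ zero * E zero x x)             ≈⟨ x∙yz≈y∙xz (fromℕ n) (θ zero) (E zero x x) ⟩
      θ zero * (fromℕ n * E zero x x)             ≈⟨ *-cong θ₀≈k (E₀ x x) ⟩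
      fromℕ k * 1#                                ≈⟨ *-identityʳ (fromℕ k) ⟩
      fromℕ k                                     ∎)

    -- n N³ + s k J = n s N + k³ J, stated over ℕ so that no subtraction occurs.
    cubic : ∀ s → (∀ i → θ (suc i) * θ (suc i) * θ (suc i) ≈ fromℕ s * θ (suc i)) →
            ∀ x y → n *ℕ (N ℕᴹ.*ᴹ N ℕᴹ.*ᴹ N) x y +ℕ s *ℕ k ≡ n *ℕ (s *ℕ N x y) +ℕ k *ℕ k *ℕ k
    cubic s θ³≈sθ x y = fromℕ-injective char0 _ _ (begin
      fromℕ (n *ℕ N³ x y +ℕ s *ℕ k)
        ≈⟨ K.trans (×-homo-+ 1# (n *ℕ N³ x y) (s *ℕ k)) (+-cong (×1-homo-* n (N³ x y)) (×1-homo-* s k)) ⟩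
      n̂ * fromℕ (N³ x y) + ŝ * k̂           ≈⟨ +-congʳ (*-congˡ (N³≈θ³E x y)) ⟩
      n̂ * (θ³ zero * e + sum (λ i → θ³ (suc i) * E (suc i) x y)) + ŝ * k̂
        ≈⟨ +-congʳ (*-congˡ (+-congˡ (K.trans
             (sum-cong-≋ λ i → K.trans (*-congʳ (θ³≈sθ i)) (*-assoc ŝ (θ (suc i)) (E (suc i) x y)))
             (K.sym (*-distribˡ-sum ŝ λ i → θ (suc i) * E (suc i) x y))))) ⟩
      n̂ * (θ³ zero * e + ŝ * t) + ŝ * k̂    ≈⟨ +-congʳ (split (θ³ zero)) ⟩
      θ³ zero + n̂ * (ŝ * t) + ŝ * k̂        ≈⟨ +-cong (+-congʳ (*-cong (*-cong θ₀≈k θ₀≈k) θ₀≈k)) (*-congˡ (K.sym θ₀≈k)) ⟩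
      k̂ * k̂ * k̂ + n̂ * (ŝ * t) + ŝ * θ zero ≈⟨ +-assoc (k̂ * k̂ * k̂) (n̂ * (ŝ * t)) (ŝ * θ zero) ⟩
      k̂ * k̂ * k̂ + (n̂ * (ŝ * t) + ŝ * θ zero) ≈⟨ +-comm _ _ ⟩
      n̂ * (ŝ * t) + ŝ * θ zero + k̂ * k̂ * k̂ ≈⟨ +-congʳ (+-comm _ _) ⟩
      ŝ * θ zero + n̂ * (ŝ * t) + k̂ * k̂ * k̂ ≈⟨ +-congʳ (split (ŝ * θ zero)) ⟨
      n̂ * (ŝ * θ zero * e + ŝ * t) + k̂ * k̂ * k̂
        ≈⟨ +-congʳ (*-congˡ (+-congʳ (*-assoc ŝ (θ zero) e))) ⟩
      n̂ * (ŝ * (θ zero * e) + ŝ * t) + k̂ * k̂ * k̂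
        ≈⟨ +-congʳ (*-congˡ (distribˡ ŝ (θ zero * e) t)) ⟨
      n̂ * (ŝ * (θ zero * e + t)) + k̂ * k̂ * k̂ ≈⟨ +-congʳ (*-congˡ (*-congˡ (N≈θE x y))) ⟨
      n̂ * (ŝ * fromℕ (N x y)) + k̂ * k̂ * k̂
        ≈⟨ +-cong (K.trans (×1-homo-* n (s *ℕ N x y)) (*-congˡ (×1-homo-* s (N x y))))
                  (K.trans (×1-homo-* (k *ℕ k) k) (*-congʳ (×1-homo-* k k))) ⟨
      fromℕ (n *ℕ (s *ℕ N x y)) + fromℕ (k *ℕ k *ℕ k)
        ≈⟨ ×-homo-+ 1# (n *ℕ (s *ℕ N x y)) (k *ℕ k *ℕ k) ⟨
      fromℕ (n *ℕ (s *ℕ N x y) +ℕ k *ℕ k *ℕ k) ∎)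
      where
      N³ : Matrix ℕ n n
      N³ = N ℕᴹ.*ᴹ N ℕᴹ.*ᴹ N

      n̂ ŝ k̂ e t : Carrier
      n̂ = fromℕ n
      ŝ = fromℕ s
      k̂ = fromℕ k
      e = E zero x y
      t = sum (λ i → θ (suc i) * E (suc i) x y)

      θ³ : Vector Carrier (suc d)
      θ³ i = θ i * θ i * θ i

      -- Holds because `n̂ * e` is an entry of `J`. It serves both sides: `u = θ³ zero` comes from
      -- `N³` and `u = ŝ * θ zero` from `s N`. The tails `n̂ * (ŝ * t)` agree, so the two sides
      -- differ only in their components at `E zero`.
      split : ∀ u → n̂ * (u * e + ŝ * t) ≈ u + n̂ * (ŝ * t)
      split u = begin
        n̂ * (u * e + ŝ * t)          ≈⟨ distribˡ n̂ (u * e) (ŝ * t) ⟩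
        n̂ * (u * e) + n̂ * (ŝ * t)    ≈⟨ +-congʳ (x∙yz≈y∙xz n̂ u e) ⟩
        u * (n̂ * e) + n̂ * (ŝ * t)    ≈⟨ +-congʳ (*-congˡ (E₀ x y)) ⟩
        u * 1# + n̂ * (ŝ * t)         ≈⟨ +-congʳ (*-identityʳ u) ⟩
        u + n̂ * (ŝ * t)              ∎

      N³≈θ³E : embed N³ ≈ᴹ linComb θ³ E
      N³≈θ³E = 𝕄.trans (embed-*ᴹ (N ℕᴹ.*ᴹ N) N)
        (𝕄.trans (*ᴹ-cong (𝕄.trans (embed-*ᴹ N N)
                   (𝕄.trans (*ᴹ-cong N≈θE N≈θE) (linCombE*linCombE θ θ))) N≈θE)
          (linCombE*linCombE (λ i → θ i * θ i) θ))

-- The eigenvalues 0, m and -m as roots of x³ = m²x.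

module RootsOfCubic {c ℓ₁ ℓ₂} (K : HeytingField c ℓ₁ ℓ₂) where
  open CommutativeRing (fieldRing K) hiding (zero; refl; sym; trans)
  open RingProperties ring using (-‿distribˡ-*; -‿distribʳ-*; -‿involutive)
  open SemiringMult semiring using (×-homo-+; ×1-homo-*)
  open MatrixOps (fieldSemiring K) using (fromℕ)
  open SetoidReasoning setoid
  private module K = CommutativeRing (fieldRing K)

  fromℕ-1 : fromℕ 1 ≈ 1#
  fromℕ-1 = +-identityʳ 1#

  fromℕ-+1 : ∀ i → fromℕ (i +ℕ 1) ≈ fromℕ i + 1#
  fromℕ-+1 i = K.trans (×-homo-+ 1# i 1) (+-congˡ fromℕ-1)

  fromℕ-^2 : ∀ m → fromℕ (m ^ℕ 2) ≈ fromℕ m * fromℕ m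
  fromℕ-^2 m = K.trans (×1-homo-* m (m *ℕ 1)) (*-congˡ (K.reflexive (cong fromℕ (ℕ.*-identityʳ m))))

  [x-y]+y≈x : ∀ x y → x - y + y ≈ x
  [x-y]+y≈x x y = begin
    x - y + y      ≈⟨ +-assoc x (- y) y ⟩
    x + (- y + y)  ≈⟨ +-congˡ (-‿inverseˡ y) ⟩
    x + 0#         ≈⟨ +-identityʳ x ⟩
    x              ∎

  -- `fromℕ (suc m′)` unfolds to `1# + fromℕ m′`, so this identifies the factor m - 1 of the table
  -- with the natural number `m′`, to which `m ∸ 1` computes.
  1+x-1≈x : ∀ x → 1# + x - 1# ≈ x
  1+x-1≈x x = begin
    1# + x - 1#    ≈⟨ +-congʳ (+-comm 1# x) ⟩
    x + 1# - 1#    ≈⟨ +-assoc x 1# (- 1#) ⟩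
    x + (1# - 1#)  ≈⟨ +-congˡ (-‿inverseʳ 1#) ⟩
    x + 0#         ≈⟨ +-identityʳ x ⟩
    x              ∎

  infix 4 _isRootFor_
  _isRootFor_ : Carrier → ℕ → Set ℓ₁
  x isRootFor m = x * x * x ≈ fromℕ (m ^ℕ 2) * x

  isRoot-resp : ∀ {x y m} → x ≈ y → y isRootFor m → x isRootFor m
  isRoot-resp x≈y root = K.trans (*-cong (*-cong x≈y x≈y) x≈y) (K.trans root (*-congˡ (K.sym x≈y)))

  isRoot-0 : ∀ m → 0# isRootFor m
  isRoot-0 m = K.trans (zeroʳ (0# * 0#)) (K.sym (zeroʳ (fromℕ (m ^ℕ 2))))

  isRoot-m : ∀ m → fromℕ m isRootFor m
  isRoot-m m = *-congʳ (K.sym (fromℕ-^2 m))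

  isRoot--m : ∀ m → - fromℕ m isRootFor m
  isRoot--m m = *-congʳ (begin
    - fromℕ m * - fromℕ m      ≈⟨ -‿distribˡ-* (fromℕ m) (- fromℕ m) ⟨
    - (fromℕ m * - fromℕ m)    ≈⟨ -‿cong (-‿distribʳ-* (fromℕ m) (fromℕ m)) ⟨
    - - (fromℕ m * fromℕ m)    ≈⟨ -‿involutive (fromℕ m * fromℕ m) ⟩
    fromℕ m * fromℕ m          ≈⟨ fromℕ-^2 m ⟨
    fromℕ (m ^ℕ 2)             ∎)

-- From the cubic identity over ℕ to the design equation over ℚ.

open import Data.Integer.Base using (+_; _+_; _-_; _*_; _^_)
open import Data.Rational.Base using (_/_)
open SymmetricAssociationScheme using (A)
open ℕᴹ using (_+ᴹ_)

-- Since `j / 3` is reduced to lowest terms, the comparison is made among unnormalised rationals,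
-- where it is the cross-multiplied hypothesis.
fromℕ≡/ : ∀ i j → + 3 * + i ≡ j → ℚᴹ.fromℕ i ≡ j / 3
fromℕ≡/ i j 3i≡j = ℚ.toℚᵘ-injective (ℚᵘ.≃-trans (toℚᵘ-fromℕ i)
  (ℚᵘ.≃-trans (ℚᵘ.*≡* (trans (ℤ.*-comm (+ i) (+ 3)) (trans 3i≡j (sym (ℤ.*-identityʳ j)))))
    -- `mkℚᵘ` takes the denominator minus one, so `2` encodes the denominator 3.
    (ℚᵘ.≃-sym (ℚ.toℚᵘ-fromℚᵘ (ℚᵘ.mkℚᵘ j 2)))))
  where
  toℚᵘ-fromℕ : ∀ i → ℚ.toℚᵘ (ℚᴹ.fromℕ i) ℚᵘ.≃ ℚᵘ.mkℚᵘ (+ i) 0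
  toℚᵘ-fromℕ zero    = ℚᵘ.≃-refl
  toℚᵘ-fromℕ (suc i) = ℚᵘ.≃-trans (ℚ.toℚᵘ-homo-+ ℚ.1ℚ (ℚᴹ.fromℕ i))
    (ℚᵘ.≃-trans (ℚᵘ.+-congʳ ℚᵘ.1ℚᵘ (toℚᵘ-fromℕ i)) (ℚᵘ.*≡* (1+i≃suci (+ i))))
    where
    1+i≃suci : ∀ i → (+ 1 * + 1 + i * + 1) * + 1 ≡ (+ 1 + i) * + 1
    1+i≃suci = ℤSolver.solve-∀

-- Here `a` = 3α, `b` = 3β and `s` = m². The last two hypotheses are β - α = s and α = (k³ - sk) /
-- 3s with denominators cleared.
cubic⇒symmetricPGD : ∀ {n} (N : Matrix ℕ n n) (v s k : ℕ) (a b : ℤ.ℤ) .{{_ : NonZero s}} →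
  n ≡ v → v ≡ 3 *ℕ s → IsZeroOne N → transpose N ℕᴹ.≈ᴹ N →
  (∀ x → ℕᴹ.sum (N x) ≡ k) →
  (∀ x y → n *ℕ (N ℕᴹ.*ᴹ N ℕᴹ.*ᴹ N) x y +ℕ s *ℕ k ≡ n *ℕ (s *ℕ N x y) +ℕ k *ℕ k *ℕ k) →
  b ≡ + 3 * + s + a → + s * a + + s * + k ≡ + k * + k * + k →
  IsSymmetricPGD N v k (a / 3) (b / 3)
cubic⇒symmetricPGD {n} N v s@(suc _) k a b n≡v v≡3s N01 Nᵀ≈N rowSum cubic b≡3s+a sa+sk≡k³ = record
  { points≡v = n≡v
  ; blocks≡v = n≡v
  ; zeroOne = N01
  ; blockSize = λ y → trans (sum-cong-≋ λ x → Nᵀ≈N y x) (rowSum y)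
  ; replication = rowSum
  ; NNᵀN = λ x y → trans (NNᵀN≡N³ x y) (N³≡βN+α[J-N] x y)
  }
  where
  open SemiringSum ℕ.+-*-semiring using (sum-cong-≋)
  module ℚP = MatrixProperties (CommutativeRing.commutativeSemiring ℚ.+-*-commutativeRing)
  open RingProperties ℤ.+-*-ring using (+-cancelʳ)
  open ≡-Reasoning

  N³ : Matrix ℕ n n
  N³ = N ℕᴹ.*ᴹ N ℕᴹ.*ᴹ N

  NNᵀN≡N³ : ∀ x y → (ℚᴹ.embed N ℚᴹ.*ᴹ transpose (ℚᴹ.embed N) ℚᴹ.*ᴹ ℚᴹ.embed N) x y ≡ ℚᴹ.fromℕ (N³ x y)
  NNᵀN≡N³ x y = begin
    (ℚN ℚᴹ.*ᴹ transpose ℚN ℚᴹ.*ᴹ ℚN) x y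
      ≡⟨ ℚP.*ᴹ-cong {N = ℚN} (ℚP.*ᴹ-cong {M = ℚN} (λ _ _ → refl) (ℚP.embed-cong Nᵀ≈N)) (λ _ _ → refl) x y ⟩
    (ℚN ℚᴹ.*ᴹ ℚN ℚᴹ.*ᴹ ℚN) x y
      ≡⟨ ℚP.*ᴹ-cong {N = ℚN} (ℚP.embed-*ᴹ N N) (λ _ _ → refl) x y ⟨
    (ℚᴹ.embed (N ℕᴹ.*ᴹ N) ℚᴹ.*ᴹ ℚN) x y
      ≡⟨ ℚP.embed-*ᴹ (N ℕᴹ.*ᴹ N) N x y ⟨
    ℚᴹ.fromℕ (N³ x y) ∎
    where
    ℚN : Matrix ℚ.ℚ n n
    ℚN = ℚᴹ.embed N

  3N³ : ∀ x y → + 3 * + N³ x y ≡ + 3 * (+ s * + N x y) + a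
  -- Once `n` is replaced by 3s and k³ by sa + sk, both sides of `cubic` share the summand sk, and
  -- what remains has the positive factor `s`.
  3N³ x y = ℤ.*-cancelˡ-≡ (+ s) _ _ (+-cancelʳ (+ s * + k) _ _ (begin
    + s * (+ 3 * + t) + + s * + k
      ≡⟨ assoc₁ (+ s) (+ t) (+ k) ⟩
    + 3 * + s * + t + + s * + k
      ≡⟨ pos₁ ⟨
    + (3 *ℕ s *ℕ t +ℕ s *ℕ k)
      ≡⟨ cong (+_) (subst (λ n → n *ℕ t +ℕ s *ℕ k ≡ n *ℕ (s *ℕ N x y) +ℕ k *ℕ k *ℕ k) (trans n≡v v≡3s) (cubic x y)) ⟩
    + (3 *ℕ s *ℕ (s *ℕ N x y) +ℕ k *ℕ k *ℕ k)
      ≡⟨ pos₂ ⟩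
    + 3 * + s * (+ s * + N x y) + + k * + k * + k
      ≡⟨ cong (λ i → + 3 * + s * (+ s * + N x y) + i) sa+sk≡k³ ⟨
    + 3 * + s * (+ s * + N x y) + (+ s * a + + s * + k)
      ≡⟨ assoc₂ (+ s) (+ N x y) a (+ k) ⟩
    + s * (+ 3 * (+ s * + N x y) + a) + + s * + k ∎))
    where
    t : ℕ
    t = N³ x y

    pos-** : ∀ i j l → + (i *ℕ j *ℕ l) ≡ + i * + j * + l
    pos-** i j l = trans (ℤ.pos-* (i *ℕ j) l) (cong (λ h → h * + l) (ℤ.pos-* i j))

    pos₁ : + (3 *ℕ s *ℕ t +ℕ s *ℕ k) ≡ + 3 * + s * + t + + s * + k
    pos₁ = trans (ℤ.pos-+ (3 *ℕ s *ℕ t) (s *ℕ k)) (cong₂ _+_ (pos-** 3 s t) (ℤ.pos-* s k))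

    pos₂ : + (3 *ℕ s *ℕ (s *ℕ N x y) +ℕ k *ℕ k *ℕ k) ≡ + 3 * + s * (+ s * + N x y) + + k * + k * + k
    pos₂ = trans (ℤ.pos-+ (3 *ℕ s *ℕ (s *ℕ N x y)) (k *ℕ k *ℕ k))
      (cong₂ _+_ (trans (pos-** 3 s (s *ℕ N x y)) (cong (λ h → + 3 * + s * h) (ℤ.pos-* s (N x y)))) (pos-** k k k))

    assoc₁ : ∀ s t k → s * (+ 3 * t) + s * k ≡ + 3 * s * t + s * k
    assoc₁ = ℤSolver.solve-∀

    assoc₂ : ∀ s e a k → + 3 * s * (s * e) + (s * a + s * k) ≡ s * (+ 3 * (s * e) + a) + s * k
    assoc₂ = ℤSolver.solve-∀

  N³≡βN+α[J-N] : ∀ x y → ℚᴹ.fromℕ (N³ x y) ≡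
    (b / 3) ℚ.* ℚᴹ.fromℕ (N x y) ℚ.+ (a / 3) ℚ.* (ℚ.1ℚ ℚ.- ℚᴹ.fromℕ (N x y))
  -- The right side is α at an entry 0 and β at an entry 1, so `3N³` only has to be compared with
  -- `a` or with `b`.
  N³≡βN+α[J-N] x y with N x y | N01 x y | 3N³ x y
  ... | _ | inj₁ refl | 3t≡3s*0+a = begin
    ℚᴹ.fromℕ (N³ x y)                            ≡⟨ fromℕ≡/ (N³ x y) a (trans 3t≡3s*0+a (3s*0+a≡a (+ s) a)) ⟩
    a / 3                                        ≡⟨ ℚ.+-identityˡ (a / 3) ⟨
    ℚ.0ℚ ℚ.+ a / 3                               ≡⟨ cong₂ ℚ._+_ (ℚ.*-zeroʳ (b / 3)) (ℚ.*-identityʳ (a / 3)) ⟨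
    (b / 3) ℚ.* ℚ.0ℚ ℚ.+ (a / 3) ℚ.* ℚ.1ℚ        ∎
    where
    3s*0+a≡a : ∀ s a → + 3 * (s * + 0) + a ≡ a
    3s*0+a≡a = ℤSolver.solve-∀
  ... | _ | inj₂ refl | 3t≡3s*1+a = begin
    ℚᴹ.fromℕ (N³ x y)                            ≡⟨ fromℕ≡/ (N³ x y) b (trans 3t≡3s*1+a (trans (3s*1+a≡3s+a (+ s) a) (sym b≡3s+a))) ⟩
    b / 3                                        ≡⟨ ℚ.+-identityʳ (b / 3) ⟨
    b / 3 ℚ.+ ℚ.0ℚ                               ≡⟨ cong₂ ℚ._+_ (ℚ.*-identityʳ (b / 3)) (ℚ.*-zeroʳ (a / 3)) ⟨
    (b / 3) ℚ.* ℚ.1ℚ ℚ.+ (a / 3) ℚ.* ℚ.0ℚ        ∎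
    where
    3s*1+a≡3s+a : ∀ s a → + 3 * (s * + 1) + a ≡ + 3 * s + a
    3s*1+a≡3s+a = ℤSolver.solve-∀

pos-^2 : ∀ m → + (m ^ℕ 2) ≡ (+ m) ^ 2
pos-^2 m = trans (ℤ.pos-* m (m *ℕ 1)) (cong (λ i → + m * i) (ℤ.pos-* m 1))

sum-ones : ∀ n → ℕᴹ.sum {n} (λ _ → 1) ≡ n
sum-ones zero    = refl
sum-ones (suc n) = cong suc (sum-ones n)

-- The three designs of the given character table.

module ThreeDesigns {c ℓ₁ ℓ₂} (K : HeytingField c ℓ₁ ℓ₂) (char0 : CharacteristicZero K)
  (m′ : ℕ) {n} (𝒵 : SymmetricAssociationScheme 3 n)
  (ct : IsCharacterTable K 𝒵 (table K (suc m′))) where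

  open CommutativeRing (fieldRing K) hiding (zero; refl; sym; trans; _+_; _*_; _-_)
  open CommutativeRing (fieldRing K) using () renaming (_+_ to _+ᴷ_; _*_ to _*ᴷ_)
  open SemiringMult semiring using (×-homo-+; ×1-homo-*)
  open MatrixOps (fieldSemiring K) using (fromℕ; linComb; embed; _≈ᴹ_)
  open MatrixProperties commutativeSemiring using (linComb-+)
  open SymmetricAssociationScheme 𝒵 using (zeroOne; symmetric; sum≈J)
  open SpectralDecomposition K 𝒵 ct
  open RootsOfCubic K
  private module K = CommutativeRing (fieldRing K)

  m : ℕ
  m = suc m′

  N₃ : Matrix ℕ n n
  N₃ = A 𝒵 3F +ᴹ A 𝒵 0F

  θ₁ θ₂ θ₃ : Vector Carrier 4
  θ₁ i = table K m i 1F
  θ₂ i = table K m i 2F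
  θ₃ i = table K m i 3F +ᴷ table K m i 0F

  θ₁₀ : θ₁ 0F ≈ fromℕ (m *ℕ (m ∸ 1))
  θ₁₀ = K.trans (*-congˡ (1+x-1≈x (fromℕ m′))) (K.sym (×1-homo-* m m′))

  θ₂₀ : θ₂ 0F ≈ fromℕ (m *ℕ (m +ℕ 1))
  θ₂₀ = K.trans (*-congˡ (K.sym (fromℕ-+1 m))) (K.sym (×1-homo-* m (m +ℕ 1)))

  θ₃₀ : θ₃ 0F ≈ fromℕ (m ^ℕ 2)
  θ₃₀ = begin
    (fromℕ m K.- 1#) *ᴷ (fromℕ m +ᴷ 1#) +ᴷ 1#
      ≈⟨ +-congʳ (*-cong (1+x-1≈x (fromℕ m′)) (K.sym (fromℕ-+1 m))) ⟩
    fromℕ m′ *ᴷ fromℕ (m +ℕ 1) +ᴷ 1#     ≈⟨ +-congʳ (×1-homo-* m′ (m +ℕ 1)) ⟨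
    fromℕ (m′ *ℕ (m +ℕ 1)) +ᴷ 1#         ≈⟨ fromℕ-+1 (m′ *ℕ (m +ℕ 1)) ⟨
    fromℕ (m′ *ℕ (m +ℕ 1) +ℕ 1)          ≡⟨ cong fromℕ (factor m′) ⟩
    fromℕ (m ^ℕ 2)                       ∎
    where
    open SetoidReasoning setoid
    factor : ∀ i → i *ℕ (suc i +ℕ 1) +ℕ 1 ≡ suc i *ℕ (suc i *ℕ 1)
    factor = ℕSolver.solve-∀

  roots₁ : ∀ i → θ₁ (suc i) isRootFor m
  roots₁ 0F = isRoot-m m
  roots₁ 1F = isRoot-0 m
  roots₁ 2F = isRoot--m m

  roots₂ : ∀ i → θ₂ (suc i) isRootFor m
  roots₂ 0F = isRoot-0 m
  roots₂ 1F = isRoot--m m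
  roots₂ 2F = isRoot-m m

  -- Adding the column of `A₀`, which is constantly 1, turns -m-1, m-1, -1 into -m, m, 0. This shift
  -- is why `A₀` is added to the third relation.
  roots₃ : ∀ i → θ₃ (suc i) isRootFor m
  roots₃ 0F = isRoot-resp {m = m} ([x-y]+y≈x (- fromℕ m) 1#) (isRoot--m m)
  roots₃ 1F = isRoot-resp {m = m} ([x-y]+y≈x (fromℕ m) 1#) (isRoot-m m)
  roots₃ 2F = isRoot-resp {m = m} (-‿inverseˡ 1#) (isRoot-0 m)

  N₃-expansion : embed N₃ ≈ᴹ linComb θ₃ E
  N₃-expansion x y = K.trans (×-homo-+ 1# (A 𝒵 3F x y) (A 𝒵 0F x y))
    (K.trans (+-cong (expansion 3F x y) (expansion 0F x y))
      (linComb-+ (λ i → table K m i 3F) (λ i → table K m i 0F) E x y))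

  module S₁ = Spectrum char0 (A 𝒵 1F) θ₁ (expansion 1F) (m *ℕ (m ∸ 1)) θ₁₀
  module S₂ = Spectrum char0 (A 𝒵 2F) θ₂ (expansion 2F) (m *ℕ (m +ℕ 1)) θ₂₀
  module S₃ = Spectrum char0 N₃ θ₃ N₃-expansion (m ^ℕ 2) θ₃₀

  n≡3m² : n ≡ 3 *ℕ m ^ℕ 2
  n≡3m² = begin
    n                                                   ≡⟨ sum-ones n ⟨
    ℕᴹ.sum {n} (λ _ → 1)                                ≡⟨ sum-cong-≋ (λ y → trans (sym (sum≈J x y)) (regroup (A 𝒵 0F x y) (A 𝒵 1F x y) (A 𝒵 2F x y) (A 𝒵 3F x y))) ⟩
    ℕᴹ.sum (λ y → A 𝒵 1F x y +ℕ (A 𝒵 2F x y +ℕ N₃ x y))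
      ≡⟨ ∑-distrib-+ (A 𝒵 1F x) (λ y → A 𝒵 2F x y +ℕ N₃ x y) ⟩
    ℕᴹ.sum (A 𝒵 1F x) +ℕ ℕᴹ.sum (λ y → A 𝒵 2F x y +ℕ N₃ x y)
      ≡⟨ cong₂ _+ℕ_ (S₁.rowSum x) (trans (∑-distrib-+ (A 𝒵 2F x) (N₃ x)) (cong₂ _+ℕ_ (S₂.rowSum x) (S₃.rowSum x))) ⟩
    m *ℕ m′ +ℕ (m *ℕ (m +ℕ 1) +ℕ m ^ℕ 2)                ≡⟨ total m′ ⟩
    3 *ℕ m ^ℕ 2                                         ∎
    where
    open ≡-Reasoning
    open SemiringSum ℕ.+-*-semiring using (sum-cong-≋; ∑-distrib-+)

    x : Fin n
    x = inhabited

    regroup : ∀ a b c d → a +ℕ (b +ℕ (c +ℕ (d +ℕ 0))) ≡ b +ℕ (c +ℕ (d +ℕ a))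
    regroup = ℕSolver.solve-∀

    total : ∀ i → suc i *ℕ i +ℕ (suc i *ℕ (suc i +ℕ 1) +ℕ suc i *ℕ (suc i *ℕ 1)) ≡ 3 *ℕ (suc i *ℕ (suc i *ℕ 1))
    total = ℕSolver.solve-∀

  N₃-zeroOne : IsZeroOne N₃
  N₃-zeroOne x y with A 𝒵 0F x y | A 𝒵 3F x y | zeroOne 0F x y | zeroOne 3F x y | sum≈J x y
  ... | _ | _ | inj₁ refl | inj₁ refl | _ = inj₁ refl
  ... | _ | _ | inj₁ refl | inj₂ refl | _ = inj₂ refl
  ... | _ | _ | inj₂ refl | inj₁ refl | _ = inj₂ refl
  -- Two ones here would make the corresponding entry of `J` at least 2.
  ... | _ | _ | inj₂ refl | inj₂ refl | 1+b+c+1≡1 =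
    ⊥-elim (ℕ.1+n≢0 (trans (sym (rearrange (A 𝒵 1F x y) (A 𝒵 2F x y))) (ℕ.suc-injective 1+b+c+1≡1)))
    where
    rearrange : ∀ b c → b +ℕ (c +ℕ (1 +ℕ 0)) ≡ suc (b +ℕ c)
    rearrange = ℕSolver.solve-∀

  N₃-symmetric : transpose N₃ ℕᴹ.≈ᴹ N₃
  N₃-symmetric x y = cong₂ _+ℕ_ (symmetric 3F x y) (symmetric 0F x y)

  M : ℤ.ℤ
  M = + m

  -- `κ` is the block size as an integer polynomial in `M`, with `M - + 1` in place of `m ∸ 1`; the
  -- two parameter conditions then become polynomial identities over ℤ.
  symmetricPGD : ∀ N θ k (N≈θE : embed N ≈ᴹ linComb θ E) (θ₀≈k : θ 0F ≈ fromℕ k) →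
    (∀ i → θ (suc i) isRootFor m) → IsZeroOne N → transpose N ℕᴹ.≈ᴹ N → ∀ κ α β → + k ≡ κ →
    β ≡ + 3 * M ^ 2 + α → M ^ 2 * α + M ^ 2 * κ ≡ κ * κ * κ →
    IsSymmetricPGD N (3 *ℕ m ^ℕ 2) k (α / 3) (β / 3)
  symmetricPGD N θ k N≈θE θ₀≈k roots N01 Nᵀ≈N κ α β k≡κ β≡3M²+α M²α+M²κ≡κ³ =
    cubic⇒symmetricPGD N (3 *ℕ m ^ℕ 2) (m ^ℕ 2) k α β
      n≡3m² refl N01 Nᵀ≈N rowSum (cubic (m ^ℕ 2) roots)
      (trans β≡3M²+α (cong (λ s → + 3 * s + α) (sym (pos-^2 m))))
      (trans (cong₂ (λ s k → s * α + s * k) (pos-^2 m) k≡κ)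
        (trans M²α+M²κ≡κ³ (cong (λ k → k * k * k) (sym k≡κ))))
    where open Spectrum char0 N θ N≈θE k θ₀≈k

  design₁ : IsSymmetricPGD (A 𝒵 1F) (3 *ℕ m ^ℕ 2) (m *ℕ (m ∸ 1))
    ((M ^ 2 * (M ^ 2 - + 3 * M + + 2)) / 3) ((M ^ 2 * (M ^ 2 - + 3 * M + + 5)) / 3)
  design₁ = symmetricPGD (A 𝒵 1F) θ₁ (m *ℕ (m ∸ 1)) (expansion 1F) θ₁₀ roots₁ (zeroOne 1F) (symmetric 1F)
    (M * (M - + 1)) (M ^ 2 * (M ^ 2 - + 3 * M + + 2)) (M ^ 2 * (M ^ 2 - + 3 * M + + 5))
    (ℤ.pos-* m m′) (β≡3M²+α M) (M²α+M²κ≡κ³ M)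
    where
    -- Squares are unfolded because the ring solver does not recognise ℤ._^_.
    β≡3M²+α : ∀ M →
      (M * (M * + 1)) * ((M * (M * + 1)) - + 3 * M + + 5) ≡
      + 3 * (M * (M * + 1)) + (M * (M * + 1)) * ((M * (M * + 1)) - + 3 * M + + 2)
    β≡3M²+α = ℤSolver.solve-∀

    M²α+M²κ≡κ³ : ∀ M →
      (M * (M * + 1)) * ((M * (M * + 1)) * ((M * (M * + 1)) - + 3 * M + + 2)) + (M * (M * + 1)) * (M * (M - + 1)) ≡
      (M * (M - + 1)) * (M * (M - + 1)) * (M * (M - + 1))
    M²α+M²κ≡κ³ = ℤSolver.solve-∀

  design₂ : IsSymmetricPGD (A 𝒵 2F) (3 *ℕ m ^ℕ 2) (m *ℕ (m +ℕ 1))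
    ((M ^ 2 * (M ^ 2 + + 3 * M + + 2)) / 3) ((M ^ 2 * (M ^ 2 + + 3 * M + + 5)) / 3)
  design₂ = symmetricPGD (A 𝒵 2F) θ₂ (m *ℕ (m +ℕ 1)) (expansion 2F) θ₂₀ roots₂ (zeroOne 2F) (symmetric 2F)
    (M * (M + + 1)) (M ^ 2 * (M ^ 2 + + 3 * M + + 2)) (M ^ 2 * (M ^ 2 + + 3 * M + + 5))
    (ℤ.pos-* m (m +ℕ 1)) (β≡3M²+α M) (M²α+M²κ≡κ³ M)
    where
    β≡3M²+α : ∀ M →
      (M * (M * + 1)) * ((M * (M * + 1)) + + 3 * M + + 5) ≡
      + 3 * (M * (M * + 1)) + (M * (M * + 1)) * ((M * (M * + 1)) + + 3 * M + + 2)
    β≡3M²+α = ℤSolver.solve-∀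

    M²α+M²κ≡κ³ : ∀ M →
      (M * (M * + 1)) * ((M * (M * + 1)) * ((M * (M * + 1)) + + 3 * M + + 2)) + (M * (M * + 1)) * (M * (M + + 1)) ≡
      (M * (M + + 1)) * (M * (M + + 1)) * (M * (M + + 1))
    M²α+M²κ≡κ³ = ℤSolver.solve-∀

  design₃ : IsSymmetricPGD N₃ (3 *ℕ m ^ℕ 2) (m ^ℕ 2)
    ((M ^ 2 * (M ^ 2 - + 1)) / 3) ((M ^ 2 * (M ^ 2 + + 2)) / 3)
  design₃ = symmetricPGD N₃ θ₃ (m ^ℕ 2) N₃-expansion θ₃₀ roots₃ N₃-zeroOne N₃-symmetric
    (M ^ 2) (M ^ 2 * (M ^ 2 - + 1)) (M ^ 2 * (M ^ 2 + + 2))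
    (pos-^2 m) (β≡3M²+α M) (M²α+M²κ≡κ³ M)
    where
    β≡3M²+α : ∀ M →
      (M * (M * + 1)) * ((M * (M * + 1)) + + 2) ≡
      + 3 * (M * (M * + 1)) + (M * (M * + 1)) * ((M * (M * + 1)) - + 1)
    β≡3M²+α = ℤSolver.solve-∀

    M²α+M²κ≡κ³ : ∀ M →
      (M * (M * + 1)) * ((M * (M * + 1)) * ((M * (M * + 1)) - + 1)) + (M * (M * + 1)) * ((M * (M * + 1))) ≡
      ((M * (M * + 1))) * ((M * (M * + 1))) * ((M * (M * + 1)))
    M²α+M²κ≡κ³ = ℤSolver.solve-∀

theorem5p2 : ∀ {c ℓ₁ ℓ₂} (K : HeytingField c ℓ₁ ℓ₂) → CharacteristicZero K →
    (m : ℕ) .{{_ : NonZero m}} {n : ℕ} (𝒵 : SymmetricAssociationScheme 3 n) →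
    IsCharacterTable K 𝒵 (table K m) →
    IsSymmetricPGD (A 𝒵 1F) (3 *ℕ m ^ℕ 2) (m *ℕ (m ∸ 1))
    (((+ m) ^ 2 * ((+ m) ^ 2 - + 3 * + m + + 2)) / 3)
    (((+ m) ^ 2 * ((+ m) ^ 2 - + 3 * + m + + 5)) / 3)
    × IsSymmetricPGD (A 𝒵 2F) (3 *ℕ m ^ℕ 2) (m *ℕ (m +ℕ 1))
    (((+ m) ^ 2 * ((+ m) ^ 2 + + 3 * + m + + 2)) / 3)
    (((+ m) ^ 2 * ((+ m) ^ 2 + + 3 * + m + + 5)) / 3)
    × IsSymmetricPGD (A 𝒵 3F +ᴹ A 𝒵 0F) (3 *ℕ m ^ℕ 2) (m ^ℕ 2)
    (((+ m) ^ 2 * ((+ m) ^ 2 - + 1)) / 3)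
    (((+ m) ^ 2 * ((+ m) ^ 2 + + 2)) / 3)
theorem5p2 K char0 (suc m′) 𝒵 ct = design₁ , design₂ , design₃
  where open ThreeDesigns K char0 m′ 𝒵 ct
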